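{- Let $A$ be an $m\times m$ coloring matrix, let $m'\ge1$, and let $A'$ be the $(m+m')\times(m+m')$ block matrix $$A'=\left[\begin{array}{c|c}A&0\\\hline \mathbf{1}&\mathbf{1}\end{array}\right],$$ where the bottom blocks are the $m'\times m$ and $m'\times m'$ all-ones matrices and the upper right block is zero. Then $$F_{A'}(x)=F_A(x)+F_{A'}(x)^2-F_{A'}(x)F_A(x)+m'x,$$ and consequently $$F_{A'}(x)=\frac{1+F_A(x)-\sqrt{(1-F_A(x))^2-4m'x}}{2}.$$
   Context: A plane tree is an unlabeled rooted tree in which the children of every vertex are linearly ordered. A coloring matrix is a square matrix $A=(a_{ij})$ with entries in $\{0,1\}$. An $A$-coloring of a plane tree assigns to each vertex a color (an index of a row of $A$) such that whenever a vertex of color $j$ is a child of a vertex of color $i$, $a_{ij}=1$. Let $t_A(n)$ be the number of pairs (plane tree with $n$ vertices, $A$-coloring of it), and $F_A(x)=\sum_{n\ge1}t_A(n)x^n$ (formal power series; the square root is the formal power series branch with constant term $1$). -}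

module Defs where

open import Data.Bool using (Bool; true; false)
import Data.Bool.Properties as Bool
open import Data.Empty using (⊥-elim)
open import Data.Fin as Fin using (Fin; zero; suc; toℕ; splitAt)
open import Data.Integer using (+_)
open import Data.List using (List; []; _∷_; length; lookup; map; concatMap; deduplicate; cartesianProductWith; allFin)
open import Data.List.Membership.Propositional using (_∈_; lose)
open import Data.List.Membership.Propositional.Properties using (∈-map⁺; ∈-concatMap⁺; ∈-cartesianProductWith⁺; ∈-allFin; ∈-deduplicate⁺; ∈-lookup)
open import Data.List.Relation.Unary.All as All using (All; []; _∷_)
open import Data.List.Relation.Unary.AllPairs using ([]; _∷_)
open import Data.List.Relation.Unary.Any using (here; there; index)
open import Data.List.Relation.Unary.Any.Properties using (lookup-index)
open import Data.List.Relation.Unary.Unique.Propositional using (Unique)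
import Data.List.Relation.Unary.Unique.DecPropositional.Properties as UniqueDec
open import Data.Nat as ℕ using (ℕ; zero; suc; _≤_; s≤s)
import Data.Nat.Properties as ℕ
open import Data.Product using (Σ; ∃; _×_; _,_; proj₁; proj₂)
open import Data.Rational as ℚ using (ℚ; 0ℚ; 1ℚ)
import Data.Rational.Properties as ℚ
open import Data.Sum using ([_,_]′)
open import Data.Unit using (⊤; tt)
open import Function using (_↔_; mk↔ₛ′)
open import Relation.Binary using (DecidableEquality)
open import Relation.Binary.PropositionalEquality using (_≡_; refl; sym; cong; cong₂)
open import Relation.Binary.PropositionalEquality.WithK using (≡-irrelevant)
open import Relation.Nullary using (Dec; yes; no; _×-dec_)

open import Algebra.Properties.CommutativeMonoid.Sum ℚ.+-0-commutativeMonoid using (sum-syntax)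

------------------------------------------------------------------------
-- Colored plane trees

data PlaneTree : Set where
  node : List PlaneTree → PlaneTree

mutual
  size : PlaneTree → ℕ
  size (node ts) = suc (sizes ts)

  sizes : List PlaneTree → ℕ
  sizes []       = 0
  sizes (t ∷ ts) = size t ℕ.+ sizes ts

-- The entries 0 and 1 are represented by false and true.
ColoringMatrix : ℕ → Set
ColoringMatrix m = Fin m → Fin m → Bool

-- One color in Fin m for every vertex of the tree, with no constraint yet.
data Coloring (m : ℕ) : PlaneTree → Set where
  node : ∀ {ts} → Fin m → All (Coloring m) ts → Coloring m (node ts)

rootColor : ∀ {m t} → Coloring m t → Fin m
rootColor (node i _) = i

mutual
  IsAColoring : ∀ {m t} → ColoringMatrix m → Coloring m t → Set
  IsAColoring A (node i cs) = AreChildrenOf A i cs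

  AreChildrenOf : ∀ {m ts} → ColoringMatrix m → Fin m → All (Coloring m) ts → Set
  AreChildrenOf A i []       = ⊤
  AreChildrenOf A i (c ∷ cs) = A i (rootColor c) ≡ true × IsAColoring A c × AreChildrenOf A i cs

ColoredTree : ∀ {m} → ColoringMatrix m → ℕ → Set
ColoredTree {m} A n = Σ PlaneTree λ t → size t ≡ n × Σ (Coloring m t) λ c → IsAColoring A c

------------------------------------------------------------------------
-- ColoredTree A n is finite

mutual
  _≟ᵗ_ : DecidableEquality PlaneTree
  node ts ≟ᵗ node us with ts ≟ᶠ us
  ... | yes refl = yes refl
  ... | no ts≢us = no λ { refl → ts≢us refl }

  _≟ᶠ_ : DecidableEquality (List PlaneTree)
  []       ≟ᶠ []       = yes refl
  []       ≟ᶠ (_ ∷ _)  = no λ ()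
  (_ ∷ _)  ≟ᶠ []       = no λ ()
  (t ∷ ts) ≟ᶠ (u ∷ us) with t ≟ᵗ u | ts ≟ᶠ us
  ... | yes refl | yes refl  = yes refl
  ... | no t≢u   | _         = no λ { refl → t≢u refl }
  ... | yes _    | no ts≢us  = no λ { refl → ts≢us refl }

mutual
  _≟ᶜ_ : ∀ {m t} → DecidableEquality (Coloring m t)
  node i cs ≟ᶜ node j ds with i Fin.≟ j | cs ≟ᶜˢ ds
  ... | yes refl | yes refl  = yes refl
  ... | no i≢j   | _         = no λ { refl → i≢j refl }
  ... | yes _    | no cs≢ds  = no λ { refl → cs≢ds refl }

  _≟ᶜˢ_ : ∀ {m ts} → DecidableEquality (All (Coloring m) ts)
  []       ≟ᶜˢ []       = yes refl
  (c ∷ cs) ≟ᶜˢ (d ∷ ds) with c ≟ᶜ d | cs ≟ᶜˢ ds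
  ... | yes refl | yes refl  = yes refl
  ... | no c≢d   | _         = no λ { refl → c≢d refl }
  ... | yes _    | no cs≢ds  = no λ { refl → cs≢ds refl }

mutual
  isAColoring? : ∀ {m t} (A : ColoringMatrix m) (c : Coloring m t) → Dec (IsAColoring A c)
  isAColoring? A (node i cs) = areChildrenOf? A i cs

  areChildrenOf? : ∀ {m ts} (A : ColoringMatrix m) i (cs : All (Coloring m) ts) → Dec (AreChildrenOf A i cs)
  areChildrenOf? A i []       = yes tt
  areChildrenOf? A i (c ∷ cs) = (A i (rootColor c) Bool.≟ true) ×-dec (isAColoring? A c ×-dec areChildrenOf? A i cs)

mutual
  isAColoring-irr : ∀ {m t} (A : ColoringMatrix m) (c : Coloring m t) (p q : IsAColoring A c) → p ≡ q
  isAColoring-irr A (node i cs) = areChildrenOf-irr A i cs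

  areChildrenOf-irr : ∀ {m ts} (A : ColoringMatrix m) i (cs : All (Coloring m) ts) (p q : AreChildrenOf A i cs) → p ≡ q
  areChildrenOf-irr A i []       _            _              = refl
  areChildrenOf-irr A i (c ∷ cs) (p , q , r) (p′ , q′ , r′) =
    cong₂ _,_ (≡-irrelevant p p′) (cong₂ _,_ (isAColoring-irr A c q q′) (areChildrenOf-irr A i cs r r′))

_≟ᶜᵗ_ : ∀ {m n} {A : ColoringMatrix m} → DecidableEquality (ColoredTree A n)
_≟ᶜᵗ_ {A = A} (t , p , c , a) (u , q , d , b) with t ≟ᵗ u
... | no t≢u = no λ { refl → t≢u refl }
... | yes refl with c ≟ᶜ d
...   | no c≢d = no λ { refl → c≢d refl }
...   | yes refl rewrite ℕ.≡-irrelevant p q | isAColoring-irr A c a b = yes refl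

-- Contains every forest with at most n vertices (and some larger ones).
forests : ℕ → List (List PlaneTree)
forests zero    = [] ∷ []
forests (suc n) = [] ∷ cartesianProductWith (λ ts us → node ts ∷ us) (forests n) (forests n)

∈-forests : ∀ n ts → sizes ts ≤ n → ts ∈ forests n
∈-forests zero    []             _       = here refl
∈-forests zero    (node _ ∷ _)   ()
∈-forests (suc n) []             _       = here refl
∈-forests (suc n) (node ts ∷ us) (s≤s p) =
  there (∈-cartesianProductWith⁺ (λ ts us → node ts ∷ us)
    (∈-forests n ts (ℕ.m+n≤o⇒m≤o (sizes ts) p))
    (∈-forests n us (ℕ.m+n≤o⇒n≤o (sizes ts) p)))

trees : ℕ → List PlaneTree
trees n = map node (forests n)

∈-trees : ∀ {n} t → size t ≡ n → t ∈ trees n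
∈-trees (node ts) refl = ∈-map⁺ node (∈-forests _ ts (ℕ.n≤1+n _))

mutual
  colorings : ∀ m t → List (Coloring m t)
  colorings m (node ts) = cartesianProductWith node (allFin m) (coloringss m ts)

  coloringss : ∀ m ts → List (All (Coloring m) ts)
  coloringss m []       = [] ∷ []
  coloringss m (t ∷ ts) = cartesianProductWith _∷_ (colorings m t) (coloringss m ts)

mutual
  ∈-colorings : ∀ {m t} (c : Coloring m t) → c ∈ colorings m t
  ∈-colorings (node i cs) = ∈-cartesianProductWith⁺ node (∈-allFin i) (∈-coloringss cs)

  ∈-coloringss : ∀ {m ts} (cs : All (Coloring m) ts) → cs ∈ coloringss m ts
  ∈-coloringss []       = here refl
  ∈-coloringss (c ∷ cs) = ∈-cartesianProductWith⁺ _∷_ (∈-colorings c) (∈-coloringss cs)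

module _ {m : ℕ} (A : ColoringMatrix m) (n : ℕ) where

  withColoring : ∀ t → size t ≡ n → Coloring m t → List (ColoredTree A n)
  withColoring t p c with isAColoring? A c
  ... | yes a = (t , p , c , a) ∷ []
  ... | no  _ = []

  ∈-withColoring : ∀ t p c a → (t , p , c , a) ∈ withColoring t p c
  ∈-withColoring t p c a with isAColoring? A c
  ... | yes b = here (cong (λ a → (t , p , c , a)) (isAColoring-irr A c a b))
  ... | no ¬a = ⊥-elim (¬a a)

  withTree : PlaneTree → List (ColoredTree A n)
  withTree t with size t ℕ.≟ n
  ... | yes p = concatMap (withColoring t p) (colorings m t)
  ... | no  _ = []

  ∈-withTree : ∀ t p c a → (t , p , c , a) ∈ withTree t
  ∈-withTree t p c a with size t ℕ.≟ n
  ... | no ¬p = ⊥-elim (¬p p)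
  ... | yes q rewrite ℕ.≡-irrelevant p q =
    ∈-concatMap⁺ (withColoring t q) (lose (∈-colorings c) (∈-withColoring t q c a))

  coloredTrees : List (ColoredTree A n)
  coloredTrees = deduplicate _≟ᶜᵗ_ (concatMap withTree (trees n))

  ∈-coloredTrees : ∀ x → x ∈ coloredTrees
  ∈-coloredTrees (t , p , c , a) =
    ∈-deduplicate⁺ _≟ᶜᵗ_ (∈-concatMap⁺ withTree (lose (∈-trees t p) (∈-withTree t p c a)))

  coloredTrees-! : Unique coloredTrees
  coloredTrees-! = UniqueDec.deduplicate-! _≟ᶜᵗ_ (concatMap withTree (trees n))

lookup-injective : ∀ {X : Set} {xs : List X} → Unique xs → ∀ i j → lookup xs i ≡ lookup xs j → i ≡ j
lookup-injective (_ ∷ _)  zero    zero    _  = refl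
lookup-injective {xs = _ ∷ xs} (x∉ ∷ _) zero    (suc j) eq = ⊥-elim (All.lookup x∉ (∈-lookup {xs = xs} j) eq)
lookup-injective {xs = _ ∷ xs} (x∉ ∷ _) (suc i) zero    eq = ⊥-elim (All.lookup x∉ (∈-lookup {xs = xs} i) (sym eq))
lookup-injective (_ ∷ u)  (suc i) (suc j) eq = cong suc (lookup-injective u i j eq)

coloredTree-finite : ∀ {m} (A : ColoringMatrix m) n → ∃ λ k → Fin k ↔ ColoredTree A n
coloredTree-finite A n = length xs , mk↔ₛ′ (lookup xs) (λ x → index (mem x))
  (λ x → sym (lookup-index (mem x)))
  (λ i → lookup-injective (coloredTrees-! A n) _ _ (sym (lookup-index (mem (lookup xs i)))))
  where
  xs  = coloredTrees A n
  mem = ∈-coloredTrees A n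

-- The cardinality of ColoredTree A n.
t : ∀ {m} → ColoringMatrix m → ℕ → ℕ
t A n = proj₁ (coloredTree-finite A n)

------------------------------------------------------------------------
-- Formal power series over ℚ, as coefficient sequences

PowerSeries : Set
PowerSeries = ℕ → ℚ

infix  4 _≈_
infixl 6 _+ˢ_ _-ˢ_
infixl 7 _*ˢ_
infixr 8 _·_

_≈_ : PowerSeries → PowerSeries → Set
f ≈ g = ∀ n → f n ≡ g n

1ˢ : PowerSeries
1ˢ zero    = 1ℚ
1ˢ (suc n) = 0ℚ

X : PowerSeries
X (suc zero) = 1ℚ
X _          = 0ℚ

_+ˢ_ : PowerSeries → PowerSeries → PowerSeries
(f +ˢ g) n = f n ℚ.+ g n

_-ˢ_ : PowerSeries → PowerSeries → PowerSeries
(f -ˢ g) n = f n ℚ.- g n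

_*ˢ_ : PowerSeries → PowerSeries → PowerSeries
(f *ˢ g) n = ∑[ k < suc n ] (f (toℕ k) ℚ.* g (n ℕ.∸ toℕ k))

_·_ : ℚ → PowerSeries → PowerSeries
(q · f) n = q ℚ.* f n

fromℕ : ℕ → ℚ
fromℕ n = + n ℚ./ 1

-- S is the branch of √ P with constant term 1.
IsSqrt : PowerSeries → PowerSeries → Set
IsSqrt P S = S 0 ≡ 1ℚ × S *ˢ S ≈ P

------------------------------------------------------------------------

F : ∀ {m} → ColoringMatrix m → PowerSeries
F A zero    = 0ℚ
F A (suc n) = fromℕ (t A (suc n))

-- The block matrix with A in the upper left corner, 0 in the upper right one,
-- and m′ further rows of ones.
extend : ∀ {m} → ColoringMatrix m → (m′ : ℕ) → ColoringMatrix (m ℕ.+ m′)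
extend {m} A m′ i j =
  [ (λ i₁ → [ (λ j₁ → A i₁ j₁) , (λ _ → false) ]′ (splitAt m j)) , (λ _ → true) ]′ (splitAt m i)

{-# OPTIONS --safe #-}

-- Write F for the A-colored trees, G for the A′-colored trees and H for the
-- A′-colored trees whose root has one of the m′ new colors. A tree whose root
-- has an old color has old colors only, so G = F + H. A vertex of new color has
-- arbitrary children, so splitting off the first subtree of the root gives
-- H = m′ x + G H. Eliminating H yields G = F + G² - G F + m′ x. The series
-- 1 - G and F - G then have product - m′ x and difference 1 - F, so the square
-- of their sum is (1 - F)² - 4 m′ x.

module Submission where

open import Defs
open import Data.Bool using (true; false)
open import Data.Empty using (⊥-elim)
open import Data.Fin as Fin using (Fin; suc; toℕ; _↑ˡ_; _↑ʳ_; splitAt)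
open import Data.Fin.Permutation using (↔⇒≡; reverse)
import Data.Fin.Properties as Fin
open import Data.Integer as ℤ using (+_)
import Data.Integer.Properties as ℤ
open import Data.List using ([]; _∷_)
open import Data.List.Relation.Unary.All as All using (All; []; _∷_)
open import Data.Nat as ℕ using (ℕ; zero; suc; _≤_; _<_)
open import Data.Nat.Induction using (<-rec)
import Data.Nat.Properties as ℕ
open import Data.Product using (Σ; ∃; ∃!; _×_; _,_; proj₁; proj₂)
open import Data.Product.Function.NonDependent.Propositional using (_×-↔_)
open import Data.Rational as ℚ using (½; 0ℚ; 1ℚ; toℚᵘ)
import Data.Rational.Properties as ℚ
open import Data.Rational.Solver using (module +-*-Solver)
import Data.Rational.Unnormalised as ℚᵘ
import Data.Rational.Unnormalised.Properties as ℚᵘ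
open import Data.Sum using (_⊎_; inj₁; inj₂)
open import Data.Sum.Function.Propositional using (_⊎-↔_)
open import Data.Unit using (tt)
open import Function using (_↔_; mk↔ₛ′; mk⤖; _∘_; module Inverse)
open import Function.Construct.Composition using (_↔-∘_)
open import Function.Construct.Identity using (↔-id)
open import Function.Construct.Symmetry using (↔-sym)
open import Function.Properties.Bijection using (⤖⇒↔)
open import Function.Related.TypeIsomorphisms using (⊎-assoc; ⊎-comm)
open import Relation.Binary.PropositionalEquality using (_≡_; refl; sym; trans; cong; cong₂; subst; module ≡-Reasoning)
open import Relation.Binary.PropositionalEquality.WithK using (≡-irrelevant)
open import Relation.Nullary using (¬_)

open import Algebra.Properties.CommutativeMonoid.Sum ℚ.+-0-commutativeMonoid using (sum-cong-≗; ∑-distrib-+; ∑-permute; sum-replicate-zero; sum-init-last)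
open ≡-Reasoning

-- The embedding of the natural numbers into the rationals.

-- Normalisation of fractions blocks computation in ℚ, so the claim is moved to unnormalised
-- fractions, where it is an integer identity after cross multiplication.
fromℕ-homo-+ : ∀ a b → fromℕ (a ℕ.+ b) ≡ fromℕ a ℚ.+ fromℕ b
fromℕ-homo-+ a b = ℚ.toℚᵘ-injective (ℚᵘ.≃-trans (toℚᵘ-fromℕ (a ℕ.+ b)) (ℚᵘ.≃-trans +-homo
  (ℚᵘ.≃-sym (ℚᵘ.≃-trans (ℚ.toℚᵘ-homo-+ (fromℕ a) (fromℕ b)) (ℚᵘ.+-cong (toℚᵘ-fromℕ a) (toℚᵘ-fromℕ b))))))
  where
  toℚᵘ-fromℕ : ∀ n → toℚᵘ (fromℕ n) ℚᵘ.≃ (+ n ℚᵘ./ 1)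
  toℚᵘ-fromℕ n = ℚ.toℚᵘ-fromℚᵘ (+ n ℚᵘ./ 1)
  +-homo : + (a ℕ.+ b) ℚᵘ./ 1 ℚᵘ.≃ (+ a ℚᵘ./ 1) ℚᵘ.+ (+ b ℚᵘ./ 1)
  +-homo = ℚᵘ.*≡* (cong (ℤ._* + 1) (sym (cong₂ ℤ._+_ (ℤ.*-identityʳ (+ a)) (ℤ.*-identityʳ (+ b)))))

fromℕ-homo-* : ∀ a b → fromℕ (a ℕ.* b) ≡ fromℕ a ℚ.* fromℕ b
fromℕ-homo-* zero    b = sym (ℚ.*-zeroˡ (fromℕ b))
fromℕ-homo-* (suc a) b = begin
  fromℕ (b ℕ.+ a ℕ.* b)                     ≡⟨ fromℕ-homo-+ b (a ℕ.* b) ⟩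
  fromℕ b ℚ.+ fromℕ (a ℕ.* b)               ≡⟨ cong (fromℕ b ℚ.+_) (fromℕ-homo-* a b) ⟩
  fromℕ b ℚ.+ fromℕ a ℚ.* fromℕ b           ≡⟨ solve 2 (λ a b → b :+ a :* b := (con 1ℚ :+ a) :* b) refl (fromℕ a) (fromℕ b) ⟩
  (1ℚ ℚ.+ fromℕ a) ℚ.* fromℕ b              ≡⟨ cong (ℚ._* fromℕ b) (fromℕ-homo-+ 1 a) ⟨
  fromℕ (suc a) ℚ.* fromℕ b                 ∎
  where open +-*-Solver

-- Ring laws of the Cauchy product.

*ˢ-cong : ∀ {f f′ g g′} → f ≈ f′ → g ≈ g′ → f *ˢ g ≈ f′ *ˢ g′
*ˢ-cong f≈f′ g≈g′ n = sum-cong-≗ {suc n} λ k → cong₂ ℚ._*_ (f≈f′ (toℕ k)) (g≈g′ (n ℕ.∸ toℕ k))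

-- Reversing the summation index, k to n - k, swaps the two factors.
*ˢ-comm : ∀ f g → f *ˢ g ≈ g *ˢ f
*ˢ-comm f g n = trans (∑-permute (λ k → f (toℕ k) ℚ.* g (n ℕ.∸ toℕ k)) reverse) (sum-cong-≗ {suc n} λ k → begin
  f (toℕ (Fin.opposite k)) ℚ.* g (n ℕ.∸ toℕ (Fin.opposite k))
    ≡⟨ cong (λ i → f i ℚ.* g (n ℕ.∸ i)) (Fin.opposite-prop k) ⟩
  f (n ℕ.∸ toℕ k) ℚ.* g (n ℕ.∸ (n ℕ.∸ toℕ k))
    ≡⟨ cong (λ i → f (n ℕ.∸ toℕ k) ℚ.* g i) (ℕ.m∸[m∸n]≡n (ℕ.s≤s⁻¹ (Fin.toℕ<n k))) ⟩
  f (n ℕ.∸ toℕ k) ℚ.* g (toℕ k)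
    ≡⟨ ℚ.*-comm (f (n ℕ.∸ toℕ k)) (g (toℕ k)) ⟩
  g (toℕ k) ℚ.* f (n ℕ.∸ toℕ k) ∎)

*ˢ-distribʳ-+ˢ : ∀ h f g → (f +ˢ g) *ˢ h ≈ f *ˢ h +ˢ g *ˢ h
*ˢ-distribʳ-+ˢ h f g n = trans
  (sum-cong-≗ {suc n} λ k → ℚ.*-distribʳ-+ (h (n ℕ.∸ toℕ k)) (f (toℕ k)) (g (toℕ k)))
  (∑-distrib-+ {suc n} (λ k → f (toℕ k) ℚ.* h (n ℕ.∸ toℕ k)) (λ k → g (toℕ k) ℚ.* h (n ℕ.∸ toℕ k)))

-- Follows from distributivity over sums, applied to f = (f - g) + g.
*ˢ-distribʳ--ˢ : ∀ h f g → (f -ˢ g) *ˢ h ≈ f *ˢ h -ˢ g *ˢ h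
*ˢ-distribʳ--ˢ h f g n = begin
  ((f -ˢ g) *ˢ h) n
    ≡⟨ solve 2 (λ x y → x := x :+ y :- y) refl (((f -ˢ g) *ˢ h) n) ((g *ˢ h) n) ⟩
  ((f -ˢ g) *ˢ h) n ℚ.+ (g *ˢ h) n ℚ.- (g *ˢ h) n
    ≡⟨ cong (ℚ._- (g *ˢ h) n) (*ˢ-distribʳ-+ˢ h (f -ˢ g) g n) ⟨
  ((f -ˢ g +ˢ g) *ˢ h) n ℚ.- (g *ˢ h) n
    ≡⟨ cong (ℚ._- (g *ˢ h) n) (*ˢ-cong {g = h} (λ k → solve 2 (λ x y → x :- y :+ y := x) refl (f k) (g k)) (λ _ → refl) n) ⟩
  (f *ˢ h) n ℚ.- (g *ˢ h) n ∎
  where open +-*-Solver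

*ˢ-distribˡ-+ˢ : ∀ h f g → h *ˢ (f +ˢ g) ≈ h *ˢ f +ˢ h *ˢ g
*ˢ-distribˡ-+ˢ h f g n = trans (*ˢ-comm h (f +ˢ g) n) (trans (*ˢ-distribʳ-+ˢ h f g n)
  (cong₂ ℚ._+_ (*ˢ-comm f h n) (*ˢ-comm g h n)))

*ˢ-distribˡ--ˢ : ∀ h f g → h *ˢ (f -ˢ g) ≈ h *ˢ f -ˢ h *ˢ g
*ˢ-distribˡ--ˢ h f g n = trans (*ˢ-comm h (f -ˢ g) n) (trans (*ˢ-distribʳ--ˢ h f g n)
  (cong₂ ℚ._-_ (*ˢ-comm f h n) (*ˢ-comm g h n)))

*ˢ-identityˡ : ∀ f → 1ˢ *ˢ f ≈ f
*ˢ-identityˡ f n = begin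
  (1ˢ *ˢ f) n        ≡⟨ cong₂ ℚ._+_ (ℚ.*-identityˡ (f n)) (trans (sum-cong-≗ {n} λ k → ℚ.*-zeroˡ (f (n ℕ.∸ suc (toℕ k)))) (sum-replicate-zero n)) ⟩
  f n ℚ.+ 0ℚ         ≡⟨ ℚ.+-identityʳ (f n) ⟩
  f n                ∎

-- Square roots of power series: uniqueness and existence.

x*2≡0⇒x≡0 : ∀ x → x ℚ.* fromℕ 2 ≡ 0ℚ → x ≡ 0ℚ
x*2≡0⇒x≡0 x eq = begin
  x                        ≡⟨ solve 1 (λ x → x := x :* con (fromℕ 2) :* con ½) refl x ⟩
  x ℚ.* fromℕ 2 ℚ.* ½      ≡⟨ cong (ℚ._* ½) eq ⟩
  0ℚ                       ∎
  where open +-*-Solver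

-- If d has no terms below degree n, then the coefficient of degree n of d e is 2 d n.
*ˢ-zero-divisor : ∀ d e → e 0 ≡ fromℕ 2 → (∀ n → (d *ˢ e) n ≡ 0ℚ) → ∀ n → d n ≡ 0ℚ
*ˢ-zero-divisor d e e₀≡2 de≈0 = <-rec _ λ n d<n≡0 → x*2≡0⇒x≡0 (d n) (begin
  d n ℚ.* fromℕ 2             ≡⟨ ℚ.+-identityˡ _ ⟨
  -- The 0 stands for the summands with k < n, which vanish by strong induction; the last summand, k
  -- = n, pairs `d n` with `e 0`.
  0ℚ ℚ.+ d n ℚ.* fromℕ 2
    ≡⟨ cong₂ ℚ._+_
         (trans (sum-cong-≗ {n} (low n d<n≡0)) (sum-replicate-zero n))
         (cong₂ ℚ._*_ (cong d (Fin.toℕ-fromℕ n)) (trans (cong e (trans (cong (n ℕ.∸_) (Fin.toℕ-fromℕ n)) (ℕ.n∸n≡0 n))) e₀≡2)) ⟨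
  _                           ≡⟨ sum-init-last {n} (λ k → d (toℕ k) ℚ.* e (n ℕ.∸ toℕ k)) ⟨
  (d *ˢ e) n                  ≡⟨ de≈0 n ⟩
  0ℚ                          ∎)
  where
  low : ∀ n → (∀ {k} → k < n → d k ≡ 0ℚ) → ∀ (k : Fin n) →
    d (toℕ (Fin.inject₁ k)) ℚ.* e (n ℕ.∸ toℕ (Fin.inject₁ k)) ≡ 0ℚ
  low n d<n≡0 k = trans
    (cong (ℚ._* e (n ℕ.∸ toℕ (Fin.inject₁ k)))
      (d<n≡0 (subst (_< n) (sym (Fin.toℕ-inject₁ k)) (Fin.toℕ<n k))))
    (ℚ.*-zeroˡ (e (n ℕ.∸ toℕ (Fin.inject₁ k))))

-- (S - T)(S + T) = S² - T² = 0, and S + T has constant term 2, so S - T must vanish.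
sqrt-unique : ∀ {P} S T → IsSqrt P S → IsSqrt P T → S ≈ T
sqrt-unique {P} S T (S₀ , SS≈P) (T₀ , TT≈P) n = begin
  S n                    ≡⟨ solve 2 (λ s t → s := s :- t :+ t) refl (S n) (T n) ⟩
  S n ℚ.- T n ℚ.+ T n    ≡⟨ cong (ℚ._+ T n) (*ˢ-zero-divisor (S -ˢ T) (S +ˢ T) (cong₂ ℚ._+_ S₀ T₀) [S-T][S+T]≈0 n) ⟩
  0ℚ ℚ.+ T n             ≡⟨ ℚ.+-identityˡ (T n) ⟩
  T n                    ∎
  where
  open +-*-Solver
  [S-T][S+T]≈0 : ∀ n → ((S -ˢ T) *ˢ (S +ˢ T)) n ≡ 0ℚ
  [S-T][S+T]≈0 n = begin
    ((S -ˢ T) *ˢ (S +ˢ T)) n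
      ≡⟨ *ˢ-distribʳ--ˢ (S +ˢ T) S T n ⟩
    (S *ˢ (S +ˢ T)) n ℚ.- (T *ˢ (S +ˢ T)) n
      ≡⟨ cong₂ ℚ._-_ (*ˢ-distribˡ-+ˢ S S T n) (*ˢ-distribˡ-+ˢ T S T n) ⟩
    ((S *ˢ S) n ℚ.+ (S *ˢ T) n) ℚ.- ((T *ˢ S) n ℚ.+ (T *ˢ T) n)
      ≡⟨ cong₂ (λ x y → (x ℚ.+ (S *ˢ T) n) ℚ.- y) (SS≈P n) (cong₂ ℚ._+_ (*ˢ-comm T S n) (TT≈P n)) ⟩
    (P n ℚ.+ (S *ˢ T) n) ℚ.- ((S *ˢ T) n ℚ.+ P n)
      ≡⟨ solve 2 (λ p q → (p :+ q) :- (q :+ p) := con 0ℚ) refl (P n) ((S *ˢ T) n) ⟩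
    0ℚ ∎

-- With p = 1 - G and q = F - G the equation reads p q = - c X, whence
-- (p + q)² = (p - q)² + 4 p q = (1 - F)² - 4 c X.
quadratic-sqrt : ∀ F G c → F 0 ≡ 0ℚ → G 0 ≡ 0ℚ →
  G ≈ F +ˢ G *ˢ G -ˢ G *ˢ F +ˢ c · X →
  IsSqrt ((1ˢ -ˢ F) *ˢ (1ˢ -ˢ F) -ˢ fromℕ 4 · c · X) ((1ˢ -ˢ G) +ˢ (F -ˢ G))
quadratic-sqrt F G c F₀ G₀ eq =
  -- The constant term (1 - 0) + (0 - 0) evaluates to 1.
  cong₂ (λ x y → (1ℚ ℚ.- y) ℚ.+ (x ℚ.- y)) F₀ G₀ , λ n → begin
    ((p +ˢ q) *ˢ (p +ˢ q)) n
      ≡⟨ *ˢ-distribʳ-+ˢ (p +ˢ q) p q n ⟩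
    (p *ˢ (p +ˢ q)) n ℚ.+ (q *ˢ (p +ˢ q)) n
      ≡⟨ cong₂ ℚ._+_ (*ˢ-distribˡ-+ˢ p p q n) (*ˢ-distribˡ-+ˢ q p q n) ⟩
    ((p *ˢ p) n ℚ.+ (p *ˢ q) n) ℚ.+ ((q *ˢ p) n ℚ.+ (q *ˢ q) n)
      ≡⟨ cong (λ x → ((p *ˢ p) n ℚ.+ (p *ˢ q) n) ℚ.+ (x ℚ.+ (q *ˢ q) n)) (*ˢ-comm q p n) ⟩
    ((p *ˢ p) n ℚ.+ (p *ˢ q) n) ℚ.+ ((p *ˢ q) n ℚ.+ (q *ˢ q) n)
      ≡⟨ solve 3 (λ pp pq qq → (pp :+ pq) :+ (pq :+ qq) := ((pp :- pq) :- (pq :- qq)) :+ con (fromℕ 4) :* pq) refl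
           ((p *ˢ p) n) ((p *ˢ q) n) ((q *ˢ q) n) ⟩
    (((p *ˢ p) n ℚ.- (p *ˢ q) n) ℚ.- ((p *ˢ q) n ℚ.- (q *ˢ q) n)) ℚ.+ fromℕ 4 ℚ.* (p *ˢ q) n
      ≡⟨ cong₂ (λ x y → x ℚ.+ fromℕ 4 ℚ.* y) ([p-q]² n) (pq≈-cX n) ⟩
    ((1ˢ -ˢ F) *ˢ (1ˢ -ˢ F)) n ℚ.+ fromℕ 4 ℚ.* (ℚ.- (c · X) n)
      ≡⟨ solve 2 (λ x y → x :+ con (fromℕ 4) :* (:- y) := x :- con (fromℕ 4) :* y) refl
           (((1ˢ -ˢ F) *ˢ (1ˢ -ˢ F)) n) ((c · X) n) ⟩
    ((1ˢ -ˢ F) *ˢ (1ˢ -ˢ F) -ˢ fromℕ 4 · c · X) n ∎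
  where
  open +-*-Solver
  p q : PowerSeries
  p = 1ˢ -ˢ G
  q = F -ˢ G

  p-q≈1-F : p -ˢ q ≈ 1ˢ -ˢ F
  p-q≈1-F n = solve 3 (λ o f g → (o :- g) :- (f :- g) := o :- f) refl (1ˢ n) (F n) (G n)

  [p-q]² : ∀ n → ((p *ˢ p) n ℚ.- (p *ˢ q) n) ℚ.- ((p *ˢ q) n ℚ.- (q *ˢ q) n) ≡ ((1ˢ -ˢ F) *ˢ (1ˢ -ˢ F)) n
  [p-q]² n = begin
    ((p *ˢ p) n ℚ.- (p *ˢ q) n) ℚ.- ((p *ˢ q) n ℚ.- (q *ˢ q) n)
      ≡⟨ cong (λ x → ((p *ˢ p) n ℚ.- (p *ˢ q) n) ℚ.- (x ℚ.- (q *ˢ q) n)) (*ˢ-comm p q n) ⟩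
    ((p *ˢ p) n ℚ.- (p *ˢ q) n) ℚ.- ((q *ˢ p) n ℚ.- (q *ˢ q) n)
      ≡⟨ cong₂ ℚ._-_ (*ˢ-distribˡ--ˢ p p q n) (*ˢ-distribˡ--ˢ q p q n) ⟨
    (p *ˢ (p -ˢ q)) n ℚ.- (q *ˢ (p -ˢ q)) n
      ≡⟨ *ˢ-distribʳ--ˢ (p -ˢ q) p q n ⟨
    ((p -ˢ q) *ˢ (p -ˢ q)) n
      ≡⟨ *ˢ-cong p-q≈1-F p-q≈1-F n ⟩
    ((1ˢ -ˢ F) *ˢ (1ˢ -ˢ F)) n ∎

  pq≈-cX : ∀ n → (p *ˢ q) n ≡ ℚ.- (c · X) n
  pq≈-cX n = begin
    (p *ˢ q) n
      ≡⟨ *ˢ-distribʳ--ˢ q 1ˢ G n ⟩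
    (1ˢ *ˢ q) n ℚ.- (G *ˢ q) n
      ≡⟨ cong₂ ℚ._-_ (*ˢ-identityˡ q n) (*ˢ-distribˡ--ˢ G F G n) ⟩
    (F n ℚ.- G n) ℚ.- ((G *ˢ F) n ℚ.- (G *ˢ G) n)
      -- Only the linear occurrence of G is expanded, so that the quadratic terms cancel.
      ≡⟨ cong (λ x → (F n ℚ.- x) ℚ.- ((G *ˢ F) n ℚ.- (G *ˢ G) n)) (eq n) ⟩
    (F n ℚ.- (F n ℚ.+ (G *ˢ G) n ℚ.- (G *ˢ F) n ℚ.+ (c · X) n)) ℚ.- ((G *ˢ F) n ℚ.- (G *ˢ G) n)
      ≡⟨ solve 4 (λ f gg gf x → (f :- (f :+ gg :- gf :+ x)) :- (gf :- gg) := :- x) refl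
           (F n) ((G *ˢ G) n) ((G *ˢ F) n) ((c · X) n) ⟩
    ℚ.- (c · X) n ∎

-- Products of counted families and convolution of their cardinalities.

infixr 7 _⊛_

-- Pairs of structures of total size n. Carrying both sizes and an equation avoids truncated
-- subtraction and lets matching on `refl` eliminate n.
_⊛_ : (ℕ → Set) → (ℕ → Set) → ℕ → Set
(P ⊛ Q) n = ∃ λ i → ∃ λ j → i ℕ.+ j ≡ n × P i × Q j

-- Peeling off index 0 and shifting f mirrors both the case split on i in `_⊛_` and the unfolding of
-- the finite sum in `_*ˢ_`.
convolution : (ℕ → ℕ) → (ℕ → ℕ) → ℕ → ℕ
convolution f g zero    = f 0 ℕ.* g 0
convolution f g (suc n) = f 0 ℕ.* g (suc n) ℕ.+ convolution (f ∘ suc) g n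

⊛-zero : ∀ {P Q} → (P 0 × Q 0) ↔ (P ⊛ Q) 0
⊛-zero = mk↔ₛ′ (λ (x , y) → 0 , 0 , refl , x , y) (λ { (zero , zero , refl , x , y) → x , y })
  (λ { (zero , zero , refl , x , y) → refl }) (λ { (x , y) → refl })

⊛-suc : ∀ {P Q n} → ((P 0 × Q (suc n)) ⊎ ((P ∘ suc) ⊛ Q) n) ↔ (P ⊛ Q) (suc n)
⊛-suc {P} {Q} {n} = mk↔ₛ′ to from
  (λ { (zero , j , refl , x , y) → refl ; (suc i , j , refl , x , y) → refl })
  (λ { (inj₁ _) → refl ; (inj₂ (i , j , refl , x , y)) → refl })
  where
  to : (P 0 × Q (suc n)) ⊎ ((P ∘ suc) ⊛ Q) n → (P ⊛ Q) (suc n)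
  to (inj₁ (x , y))                = 0 , suc n , refl , x , y
  to (inj₂ (i , j , refl , x , y)) = suc i , j , refl , x , y
  from : (P ⊛ Q) (suc n) → (P 0 × Q (suc n)) ⊎ ((P ∘ suc) ⊛ Q) n
  from (zero  , j , refl , x , y) = inj₁ (x , y)
  from (suc i , j , refl , x , y) = inj₂ (i , j , refl , x , y)

⊛-card : ∀ {P Q f g} → (∀ n → Fin (f n) ↔ P n) → (∀ n → Fin (g n) ↔ Q n) →
  ∀ n → Fin (convolution f g n) ↔ (P ⊛ Q) n
⊛-card P# Q# zero    = ⊛-zero ↔-∘ ((P# 0 ×-↔ Q# 0) ↔-∘ Fin.*↔×)
⊛-card P# Q# (suc n) =
  ⊛-suc ↔-∘ ((((P# 0 ×-↔ Q# (suc n)) ↔-∘ Fin.*↔×) ⊎-↔ ⊛-card (P# ∘ suc) Q# n) ↔-∘ Fin.+↔⊎)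

⊛-congʳ : ∀ {P Q R : ℕ → Set} → (∀ n → Q n ↔ R n) → ∀ n → (P ⊛ Q) n ↔ (P ⊛ R) n
⊛-congʳ Q↔R n = mk↔ₛ′
  (λ (i , j , e , x , y) → i , j , e , x , to (Q↔R j) y)
  (λ (i , j , e , x , y) → i , j , e , x , from (Q↔R j) y)
  (λ (i , j , e , x , y) → cong (λ z → i , j , e , x , z) (strictlyInverseˡ (Q↔R j) y))
  (λ (i , j , e , x , y) → cong (λ z → i , j , e , x , z) (strictlyInverseʳ (Q↔R j) y))
  where open Inverse

⊛-distribˡ-⊎ : ∀ {P Q R : ℕ → Set} n → (P ⊛ (λ j → Q j ⊎ R j)) n ↔ ((P ⊛ Q) n ⊎ (P ⊛ R) n)
⊛-distribˡ-⊎ n = mk↔ₛ′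
  (λ { (i , j , e , x , inj₁ y) → inj₁ (i , j , e , x , y) ; (i , j , e , x , inj₂ y) → inj₂ (i , j , e , x , y) })
  (λ { (inj₁ (i , j , e , x , y)) → i , j , e , x , inj₁ y ; (inj₂ (i , j , e , x , y)) → i , j , e , x , inj₂ y })
  (λ { (inj₁ _) → refl ; (inj₂ _) → refl })
  (λ { (_ , _ , _ , _ , inj₁ _) → refl ; (_ , _ , _ , _ , inj₂ _) → refl })

-- The coefficients of k x, counting one-vertex trees in k colors.
leaves : ℕ → ℕ → ℕ
leaves k (suc zero) = k
leaves k _          = 0

leaves-card : ∀ k n → Fin (leaves k n) ↔ (n ≡ 1 × Fin k)
leaves-card k zero          = mk↔ₛ′ (λ ()) (λ ()) (λ ()) (λ ())
leaves-card k (suc zero)    = mk↔ₛ′ (λ j → refl , j) proj₂ (λ { (refl , j) → refl }) (λ _ → refl)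
leaves-card k (suc (suc n)) = mk↔ₛ′ (λ ()) (λ ()) (λ ()) (λ ())

-- Trees colored by the extended matrix.

t-card : ∀ {m} (A : ColoringMatrix m) n → Fin (t A n) ↔ ColoredTree A n
t-card A n = proj₂ (coloredTree-finite A n)

↑ˡ≢↑ʳ : ∀ {m n} (i : Fin m) (j : Fin n) → ¬ (i ↑ˡ n ≡ m ↑ʳ j)
-- For i = 0 the equation equates `zero` with a successor, so this case suffices.
↑ˡ≢↑ʳ (suc i) j eq = ↑ˡ≢↑ʳ i j (Fin.suc-injective eq)

module Extension {m : ℕ} (A : ColoringMatrix m) (m′ : ℕ) where

  A′ : ColoringMatrix (m ℕ.+ m′)
  A′ = extend A m′

  extend-old-old : ∀ i j → A′ (i ↑ˡ m′) (j ↑ˡ m′) ≡ A i j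
  extend-old-old i j rewrite Fin.splitAt-↑ˡ m i m′ | Fin.splitAt-↑ˡ m j m′ = refl

  extend-old-new : ∀ i j → A′ (i ↑ˡ m′) (m ↑ʳ j) ≡ false
  extend-old-new i j rewrite Fin.splitAt-↑ˡ m i m′ | Fin.splitAt-↑ʳ m m′ j = refl

  extend-new : ∀ i j → A′ (m ↑ʳ i) j ≡ true
  extend-new i j rewrite Fin.splitAt-↑ʳ m m′ i = refl

  -- Fibres of the two inclusions: matching on the equation puts the color in the form `j ↑ˡ m′` or
  -- `m ↑ʳ j`.
  Old New : Fin (m ℕ.+ m′) → Set
  Old i = ∃ λ j → j ↑ˡ m′ ≡ i
  New i = ∃ λ j → m ↑ʳ j ≡ i

  old-or-new : ∀ i → Old i ⊎ New i
  old-or-new i with splitAt m i | Fin.join-splitAt m m′ i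
  ... | inj₁ j | eq = inj₁ (j , eq)
  ... | inj₂ j | eq = inj₂ (j , eq)

  -- The zero block forbids a new color below an old one.
  old-child-old : ∀ i j → A′ (i ↑ˡ m′) j ≡ true → Old j
  old-child-old i j e with old-or-new j
  ... | inj₁ o          = o
  ... | inj₂ (k , refl) with () ← trans (sym e) (extend-old-new i k)

  mutual
    embed : ∀ {t} → Coloring m t → Coloring (m ℕ.+ m′) t
    embed (node i cs) = node (i ↑ˡ m′) (embeds cs)

    embeds : ∀ {ts} → All (Coloring m) ts → All (Coloring (m ℕ.+ m′)) ts
    embeds []       = []
    embeds (c ∷ cs) = embed c ∷ embeds cs

  rootColor-embed : ∀ {t} (c : Coloring m t) → rootColor (embed c) ≡ rootColor c ↑ˡ m′
  rootColor-embed (node i cs) = refl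

  mutual
    embed-injective : ∀ {t} (c d : Coloring m t) → embed c ≡ embed d → c ≡ d
    embed-injective (node i cs) (node j ds) eq = cong₂ node
      (Fin.↑ˡ-injective m′ i j (cong rootColor eq)) (embeds-injective cs ds (cong children eq))
      where
      children : ∀ {ts} → Coloring (m ℕ.+ m′) (node ts) → All (Coloring (m ℕ.+ m′)) ts
      children (node _ cs) = cs

    embeds-injective : ∀ {ts} (cs ds : All (Coloring m) ts) → embeds cs ≡ embeds ds → cs ≡ ds
    embeds-injective []       []       _  = refl
    embeds-injective (c ∷ cs) (d ∷ ds) eq = cong₂ _∷_
      (embed-injective c d (cong All.head eq)) (embeds-injective cs ds (cong All.tail eq))

  mutual
    embed-valid : ∀ {t} (c : Coloring m t) → IsAColoring A c → IsAColoring A′ (embed c)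
    embed-valid (node i cs) = embeds-valid i cs

    embeds-valid : ∀ {ts} i (cs : All (Coloring m) ts) → AreChildrenOf A i cs → AreChildrenOf A′ (i ↑ˡ m′) (embeds cs)
    embeds-valid i []       _           = tt
    embeds-valid i (c ∷ cs) (e , a , as) =
      trans (cong (A′ (i ↑ˡ m′)) (rootColor-embed c)) (trans (extend-old-old i (rootColor c)) e) ,
      embed-valid c a , embeds-valid i cs as

  mutual
    -- Old colors propagate from the root to all descendants, so the coloring lies in the image of
    -- `embed`.
    restrict : ∀ {t} (c : Coloring (m ℕ.+ m′) t) → IsAColoring A′ c → Old (rootColor c) →
      ∃ λ d → IsAColoring A d × embed d ≡ c
    restrict (node i cs) a (j , refl) with ds , b , refl ← restricts j cs a = node j ds , b , refl

    restricts : ∀ {ts} i (cs : All (Coloring (m ℕ.+ m′)) ts) → AreChildrenOf A′ (i ↑ˡ m′) cs →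
      ∃ λ ds → AreChildrenOf A i ds × embeds ds ≡ cs
    restricts i []       _            = [] , tt , refl
    restricts i (c ∷ cs) (e , a , as)
      with d , b , refl ← restrict c a (old-child-old i (rootColor c) e)
         | ds , bs , refl ← restricts i cs as =
      d ∷ ds , (trans (sym (extend-old-old i (rootColor d))) (trans (cong (A′ (i ↑ˡ m′)) (sym (rootColor-embed d))) e) , b , bs) , refl

  -- The family counted by H.
  NewRooted : ℕ → Set
  NewRooted n = Σ PlaneTree λ t → size t ≡ n × Σ (Coloring (m ℕ.+ m′) t) λ c → IsAColoring A′ c × New (rootColor c)

  -- Ensures that the witness of a new root does not make a tree count more than once.
  New-irrelevant : ∀ {i} (p q : New i) → p ≡ q
  New-irrelevant (j , refl) (k , eq) with refl ← Fin.↑ʳ-injective m k j eq = cong (j ,_) (≡-irrelevant refl eq)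

  -- The identity G = F + H. The summands are disjoint because an embedded coloring has an old root,
  -- and they exhaust G by `restrict`.
  splitByRoot : ∀ n → (ColoredTree A n ⊎ NewRooted n) ↔ ColoredTree A′ n
  splitByRoot n = ⤖⇒↔ (mk⤖ {to = to} (injective _ _ , surjective))
    where
    to : ColoredTree A n ⊎ NewRooted n → ColoredTree A′ n
    to (inj₁ (t , p , c , a))     = t , p , embed c , embed-valid c a
    to (inj₂ (t , p , c , a , _)) = t , p , c , a

    coloring-≡ : ∀ {t p c a p′ c′ a′} → _≡_ {A = ColoredTree A′ n} (t , p , c , a) (t , p′ , c′ , a′) → c ≡ c′
    coloring-≡ refl = refl

    embed-not-new : ∀ {t} (c : Coloring m t) → ¬ New (rootColor (embed c))
    embed-not-new (node i _) (j , eq) = ↑ˡ≢↑ʳ i j (sym eq)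

    injective : ∀ x y → to x ≡ to y → x ≡ y
    injective (inj₁ (t , p , c , a)) (inj₁ (u , q , d , b)) eq with refl ← cong proj₁ eq
      with refl ← embed-injective c d (coloring-≡ eq)
      = cong₂ (λ p a → inj₁ (t , p , c , a)) (≡-irrelevant p q) (isAColoring-irr A c a b)
    injective (inj₁ (t , p , c , a)) (inj₂ (u , q , d , b , new)) eq with refl ← cong proj₁ eq
      with refl ← coloring-≡ eq = ⊥-elim (embed-not-new c new)
    injective (inj₂ (t , p , c , a , new)) (inj₁ (u , q , d , b)) eq with refl ← cong proj₁ eq
      with refl ← coloring-≡ eq = ⊥-elim (embed-not-new d new)
    injective (inj₂ (t , p , c , a , new)) (inj₂ (u , q , d , b , new′)) refl =
      cong (λ new → inj₂ (t , p , c , a , new)) (New-irrelevant new new′)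

    surjective : ∀ y → ∃ λ x → ∀ {z} → z ≡ x → to z ≡ y
    surjective (t , p , c , a) with old-or-new (rootColor c)
    ... | inj₂ new = inj₂ (t , p , c , a , new) , λ { refl → refl }
    ... | inj₁ old with d , b , refl ← restrict c a old =
      -- The validity proof rebuilt by `embed-valid` may differ from the given one, hence the appeal
      -- to irrelevance.
      inj₁ (t , p , d , b) , λ { refl → cong (λ a → t , p , embed d , a) (isAColoring-irr A′ (embed d) _ _) }

  -- The identity H = m′ x + G H. Rows of new colors are all ones, so any A′-colored tree can be
  -- attached as first child; detaching it keeps the new root color.
  splitFirstChild : ∀ n → ((n ≡ 1 × Fin m′) ⊎ (ColoredTree A′ ⊛ NewRooted) n) ↔ NewRooted n
  splitFirstChild n = mk↔ₛ′ to from to∘from from∘to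
    where
    to : (n ≡ 1 × Fin m′) ⊎ (ColoredTree A′ ⊛ NewRooted) n → NewRooted n
    to (inj₁ (refl , j)) = node [] , refl , node (m ↑ʳ j) [] , tt , j , refl
    to (inj₂ (_ , _ , e , (t , refl , c , a) , (node ts , refl , node i cs , as , j , refl))) =
      -- The root is counted in the second factor, so its `suc` has to move out of the sum.
      node (t ∷ ts) , trans (sym (ℕ.+-suc (size t) (sizes ts))) e ,
      node i (c ∷ cs) , (extend-new j (rootColor c) , a , as) , j , refl

    from : NewRooted n → (n ≡ 1 × Fin m′) ⊎ (ColoredTree A′ ⊛ NewRooted) n
    from (node [] , e , node i [] , _ , j , refl) = inj₁ (sym e , j)
    from (node (t ∷ ts) , e , node i (c ∷ cs) , (_ , a , as) , j , refl) =
      inj₂ (size t , suc (sizes ts) , trans (ℕ.+-suc (size t) (sizes ts)) e ,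
        (t , refl , c , a) , (node ts , refl , node i cs , as , j , refl))

    to∘from : ∀ x → to (from x) ≡ x
    to∘from (node [] , refl , node i [] , tt , j , refl) = refl
    to∘from (node (t ∷ ts) , e , node i (c ∷ cs) , (e′ , a , as) , j , refl) =
      cong₂ (λ e e′ → node (t ∷ ts) , e , node i (c ∷ cs) , (e′ , a , as) , j , refl)
        (≡-irrelevant _ e) (≡-irrelevant _ e′)

    from∘to : ∀ x → from (to x) ≡ x
    from∘to (inj₁ (refl , j)) = refl
    from∘to (inj₂ (_ , _ , e , (t , refl , c , a) , (node ts , refl , node i cs , as , j , refl))) =
      cong (λ e → inj₂ (size t , suc (sizes ts) , e , (t , refl , c , a) , (node ts , refl , node i cs , as , j , refl)))
        (≡-irrelevant _ e)

  -- Both sides are F ⊎ H ⊎ G ⊛ F, where F, G, H are the A-colored, the A′-colored and the new-rooted trees.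
  count-identity : ∀ n →
    t A′ n ℕ.+ convolution (t A′) (t A) n ≡ t A n ℕ.+ (leaves m′ n ℕ.+ convolution (t A′) (t A′) n)
  count-identity n = ↔⇒≡ (↔-sym right ↔-∘ left)
    where
    F⊎H⊎G⊛F : Set
    F⊎H⊎G⊛F = ColoredTree A n ⊎ (NewRooted n ⊎ (ColoredTree A′ ⊛ ColoredTree A) n)

    left : Fin (t A′ n ℕ.+ convolution (t A′) (t A) n) ↔ F⊎H⊎G⊛F
    left = ⊎-assoc _ _ _ _ ↔-∘
      (((↔-sym (splitByRoot n) ↔-∘ t-card A′ n) ⊎-↔ ⊛-card (t-card A′) (t-card A) n) ↔-∘ Fin.+↔⊎)

    -- Expanding the second factor by G = F + H gives G F + G H; the swap puts G H first, ready to
    -- be joined to m′ x.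
    G⊛G : (ColoredTree A′ ⊛ ColoredTree A′) n ↔ ((ColoredTree A′ ⊛ NewRooted) n ⊎ (ColoredTree A′ ⊛ ColoredTree A) n)
    G⊛G = ⊎-comm _ _ ↔-∘ (⊛-distribˡ-⊎ n ↔-∘ ⊛-congʳ (↔-sym ∘ splitByRoot) n)

    -- After reassociation m′ x + G H collapses to H.
    right : Fin (t A n ℕ.+ (leaves m′ n ℕ.+ convolution (t A′) (t A′) n)) ↔ F⊎H⊎G⊛F
    right = (t-card A n ⊎-↔ (((splitFirstChild n ⊎-↔ ↔-id _) ↔-∘ ↔-sym (⊎-assoc _ _ _ _)) ↔-∘
      ((leaves-card m′ n ⊎-↔ (G⊛G ↔-∘ ⊛-card (t-card A′) (t-card A′) n)) ↔-∘ Fin.+↔⊎))) ↔-∘ Fin.+↔⊎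

open Extension using (count-identity)

-- From counting to generating functions.

fromℕ-convolution : ∀ f g n → fromℕ (convolution f g n) ≡ ((fromℕ ∘ f) *ˢ (fromℕ ∘ g)) n
-- A one-term sum unfolds to that term plus 0.
fromℕ-convolution f g zero    = trans (fromℕ-homo-* (f 0) (g 0)) (sym (ℚ.+-identityʳ _))
fromℕ-convolution f g (suc n) = trans (fromℕ-homo-+ (f 0 ℕ.* g (suc n)) (convolution (f ∘ suc) g n))
  (cong₂ ℚ._+_ (fromℕ-homo-* (f 0) (g (suc n))) (fromℕ-convolution (f ∘ suc) g n))

fromℕ-leaves : ∀ k n → fromℕ (leaves k n) ≡ (fromℕ k · X) n
fromℕ-leaves k zero          = sym (ℚ.*-zeroʳ (fromℕ k))
fromℕ-leaves k (suc zero)    = sym (ℚ.*-identityʳ (fromℕ k))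
fromℕ-leaves k (suc (suc n)) = sym (ℚ.*-zeroʳ (fromℕ k))

-- No tree has 0 vertices: the enumeration evaluates to the empty list, which agrees with the
-- constant term fixed in `F`.
F≈fromℕ∘t : ∀ {m} (A : ColoringMatrix m) → F A ≈ fromℕ ∘ t A
F≈fromℕ∘t A zero    = refl
F≈fromℕ∘t A (suc n) = refl

fromℕ-convolution-t : ∀ {k l} (A : ColoringMatrix k) (B : ColoringMatrix l) n →
  fromℕ (convolution (t A) (t B) n) ≡ (F A *ˢ F B) n
fromℕ-convolution-t A B n = trans (fromℕ-convolution (t A) (t B) n)
  (*ˢ-cong (sym ∘ F≈fromℕ∘t A) (sym ∘ F≈fromℕ∘t B) n)

functional-equation : ∀ {m} (A : ColoringMatrix m) m′ → let G = F (extend A m′) in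
  G ≈ F A +ˢ G *ˢ G -ˢ G *ˢ F A +ˢ fromℕ m′ · X
functional-equation A m′ n = begin
  G n
    -- The counting identity is free of subtraction and carries G F on the left, so G F is added and
    -- subtracted first.
    ≡⟨ solve 2 (λ x y → x := x :+ y :- y) refl (G n) ((G *ˢ F A) n) ⟩
  G n ℚ.+ (G *ˢ F A) n ℚ.- (G *ˢ F A) n
    ≡⟨ cong (ℚ._- (G *ˢ F A) n) (cong₂ ℚ._+_ (F≈fromℕ∘t A′ n) (sym (fromℕ-convolution-t A′ A n))) ⟩
  fromℕ (t A′ n) ℚ.+ fromℕ (convolution (t A′) (t A) n) ℚ.- (G *ˢ F A) n
    ≡⟨ cong (ℚ._- (G *ˢ F A) n) (fromℕ-homo-+ (t A′ n) (convolution (t A′) (t A) n)) ⟨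
  fromℕ (t A′ n ℕ.+ convolution (t A′) (t A) n) ℚ.- (G *ˢ F A) n
    ≡⟨ cong (λ k → fromℕ k ℚ.- (G *ˢ F A) n) (count-identity A m′ n) ⟩
  fromℕ (t A n ℕ.+ (leaves m′ n ℕ.+ convolution (t A′) (t A′) n)) ℚ.- (G *ˢ F A) n
    ≡⟨ cong (ℚ._- (G *ˢ F A) n) (trans (fromℕ-homo-+ (t A n) _)
         (cong₂ ℚ._+_ (sym (F≈fromℕ∘t A n)) (trans (fromℕ-homo-+ (leaves m′ n) _)
           (cong₂ ℚ._+_ (fromℕ-leaves m′ n) (fromℕ-convolution-t A′ A′ n))))) ⟩
  F A n ℚ.+ ((fromℕ m′ · X) n ℚ.+ (G *ˢ G) n) ℚ.- (G *ˢ F A) n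
    ≡⟨ solve 4 (λ f x gg gf → f :+ (x :+ gg) :- gf := f :+ gg :- gf :+ x) refl
         (F A n) ((fromℕ m′ · X) n) ((G *ˢ G) n) ((G *ˢ F A) n) ⟩
  (F A +ˢ G *ˢ G -ˢ G *ˢ F A +ˢ fromℕ m′ · X) n ∎
  where
  open +-*-Solver
  A′ = extend A m′
  G  = F A′

theorem26 : (m m′ : ℕ) → 1 ≤ m′ → (A : ColoringMatrix m) →
    let FA  = F A
        FA′ = F (extend A m′)
        disc = (1ˢ -ˢ FA) *ˢ (1ˢ -ˢ FA) -ˢ fromℕ 4 · fromℕ m′ · X
    in (FA′ ≈ FA +ˢ FA′ *ˢ FA′ -ˢ FA′ *ˢ FA +ˢ fromℕ m′ · X)
       × ∃! _≈_ (IsSqrt disc)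
       × (∀ sqrt → IsSqrt disc sqrt → FA′ ≈ ½ · (1ˢ +ˢ FA -ˢ sqrt))
theorem26 m m′ _ A = functional-equation A m′ , (root , root-isSqrt , λ {S} → sqrt-unique root S root-isSqrt) , formula
  where
  open +-*-Solver
  G root : PowerSeries
  G    = F (extend A m′)
  -- This is 1 + F - 2 G, the claimed formula solved for the square root.
  root = (1ˢ -ˢ G) +ˢ (F A -ˢ G)
  disc = (1ˢ -ˢ F A) *ˢ (1ˢ -ˢ F A) -ˢ fromℕ 4 · fromℕ m′ · X

  root-isSqrt : IsSqrt disc root
  root-isSqrt = quadratic-sqrt (F A) G (fromℕ m′) refl refl (functional-equation A m′)

  formula : ∀ sqrt → IsSqrt disc sqrt → G ≈ ½ · (1ˢ +ˢ F A -ˢ sqrt)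
  formula sqrt isSqrt n = begin
    G n
      ≡⟨ solve 3 (λ o f g → g := con ½ :* (o :+ f :- ((o :- g) :+ (f :- g)))) refl (1ˢ n) (F A n) (G n) ⟩
    ½ ℚ.* (1ˢ n ℚ.+ F A n ℚ.- root n)
      ≡⟨ cong (λ s → ½ ℚ.* (1ˢ n ℚ.+ F A n ℚ.- s)) (sqrt-unique root sqrt root-isSqrt isSqrt n) ⟩
    (½ · (1ˢ +ˢ F A -ˢ sqrt)) n ∎
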